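{- Let $X\subseteq\mathbb{N}$. A total function $v$ decides $\mathbf{M}^X$ (i.e. $v(p)=1\iff p\notin\mathbf{M}^X$) if and only if $v\geq_T X'$; and the Turing degrees of such $v$ are exactly the degrees $\geq\deg(X')$. In particular the least Turing degree of a total correct adjudicator of the $X$-standard domain is $\deg(X')$: adjudication costs exactly one jump, at every level (that is, for every oracle $X$).
   Context: $(\varphi^X_e)_{e\in\mathbb{N}}$ is the standard enumeration of the unary $X$-partial computable functions; $\mathbf{M}^X=\{p\in\mathbb{N}:\varphi^X_p(0)\!\downarrow=1\}$ (the computation on input $0$ converges with value $1$). The $X$-standard domain is the pair $(\mathbb{N},\mathbf{M}^X)$. $X'$ is the Turing jump of $X$, $\leq_T$ is Turing reducibility, and $\deg(X')$ is the Turing degree of $X'$. Total functions $v$ are from $\mathbb{N}$ to $\mathbb{N}$. A total adjudicator annuls $p$ if its value at $p$ is $1$ and exempts $p$ if its value at $p$ is different from $1$; it is correct for the $X$-standard domain if it annuls exactly the non-members of $\mathbf{M}^X$. Here adjudicators are total functions of arbitrary Turing degree, so a total correct adjudicator of the $X$-standard domain is a total function $v$ with $v(p)=1\iff p\notin\mathbf{M}^X$ for all $p$.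
   Formalization: Read literally, "v ≥_T X' implies v decides M^X" is false (v = 2 + χ_{X'} never takes value 1); the formal statement proves that every correct v computes X', and that a total w computes some correct v if and only if w ≥_T X'. -}

module Defs where

open import Axiom.ExcludedMiddle using (ExcludedMiddle)
open import Data.Bool.Base using (if_then_else_)
open import Data.Nat.Base using (ℕ; zero; suc; _+_; _<_)
open import Data.Product.Base using (∃; ∃₂; _×_; _,_; proj₁; proj₂)
open import Function.Bundles using (_⇔_)
open import Level using (0ℓ)
open import Relation.Binary.Core using (Rel)
open import Relation.Binary.PropositionalEquality.Core using (_≡_)
open import Relation.Nullary.Decidable.Core using (does)
open import Relation.Unary using (Pred; _∈_; _∉_)

-- Cantor pairing: ⟨ a , b ⟩ is the position of (a , b) in the enumeration
-- (0,0), (1,0), (0,1), (2,0), (1,1), (0,2), … of ℕ × ℕ, and unpair n is the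
-- n-th entry of that enumeration.

triangle : ℕ → ℕ
triangle zero    = 0
triangle (suc n) = suc n + triangle n

⟨_,_⟩ : ℕ → ℕ → ℕ
⟨ a , b ⟩ = triangle (a + b) + b

next : ℕ × ℕ → ℕ × ℕ
next (zero  , b) = suc b , 0
next (suc a , b) = a , suc b

unpair : ℕ → ℕ × ℕ
unpair zero    = 0 , 0
unpair (suc n) = next (unpair n)

fst snd : ℕ → ℕ
fst n = proj₁ (unpair n)
snd n = proj₂ (unpair n)

-- Programs for the unary partial recursive functions relative to an oracle.
-- Functions of several arguments are handled through the pairing.

data Code : Set where
  zeroᶜ succᶜ idᶜ fstᶜ sndᶜ oracleᶜ : Code
  pairᶜ compᶜ precᶜ : Code → Code → Code
  minᶜ : Code → Code

-- A unary partial function is represented by its graph: F x y reads F(x)↓ = y.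

PrimRec : Rel ℕ 0ℓ → Rel ℕ 0ℓ → ℕ → ℕ → ℕ → Set
PrimRec F G a zero    y = F a y
PrimRec F G a (suc n) y = ∃ λ r → PrimRec F G a n r × G ⟨ a , ⟨ n , r ⟩ ⟩ y

-- y is the least zero of F⟨x,-⟩, and F⟨x,z⟩ converges for every z < y.

Minimisation : Rel ℕ 0ℓ → Rel ℕ 0ℓ
Minimisation F x y =
  F ⟨ x , y ⟩ 0 × (∀ z → z < y → ∃ λ w → F ⟨ x , z ⟩ (suc w))

⟦_⟧ : Code → (ℕ → ℕ) → Rel ℕ 0ℓ
⟦ zeroᶜ ⟧     g x y = y ≡ 0
⟦ succᶜ ⟧     g x y = y ≡ suc x
⟦ idᶜ ⟧       g x y = y ≡ x
⟦ fstᶜ ⟧      g x y = y ≡ fst x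
⟦ sndᶜ ⟧      g x y = y ≡ snd x
⟦ oracleᶜ ⟧   g x y = y ≡ g x
⟦ pairᶜ a b ⟧ g x y =
  ∃₂ λ u v → ⟦ a ⟧ g x u × ⟦ b ⟧ g x v × y ≡ ⟨ u , v ⟩
⟦ compᶜ a b ⟧ g x y = ∃ λ u → ⟦ b ⟧ g x u × ⟦ a ⟧ g u y
⟦ precᶜ a b ⟧ g x y = PrimRec (⟦ a ⟧ g) (⟦ b ⟧ g) (fst x) (snd x) y
⟦ minᶜ a ⟧    g x y = Minimisation (⟦ a ⟧ g) x y

encode : Code → ℕ
encode zeroᶜ       = ⟨ 0 , 0 ⟩
encode succᶜ       = ⟨ 1 , 0 ⟩
encode idᶜ         = ⟨ 2 , 0 ⟩
encode fstᶜ        = ⟨ 3 , 0 ⟩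
encode sndᶜ        = ⟨ 4 , 0 ⟩
encode oracleᶜ     = ⟨ 5 , 0 ⟩
encode (pairᶜ a b) = ⟨ 6 , ⟨ encode a , encode b ⟩ ⟩
encode (compᶜ a b) = ⟨ 7 , ⟨ encode a , encode b ⟩ ⟩
encode (precᶜ a b) = ⟨ 8 , ⟨ encode a , encode b ⟩ ⟩
encode (minᶜ a)    = ⟨ 9 , encode a ⟩

-- The e-th g-partial computable function.  A number that encodes no program
-- indexes the empty function.

φ : (ℕ → ℕ) → ℕ → Rel ℕ 0ℓ
φ g e x y = ∃ λ c → encode c ≡ e × ⟦ c ⟧ g x y

infix 4 _≤T_ _≡T_

_≤T_ : Rel (ℕ → ℕ) 0ℓ
f ≤T g = ∃ λ e → ∀ x → φ g e x (f x)

-- Degrees are not formed as a quotient: a total function stands for its degree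
-- and equality of degrees is _≡T_.

_≡T_ : Rel (ℕ → ℕ) 0ℓ
f ≡T g = f ≤T g × g ≤T f

Annuls : (ℕ → ℕ) → ℕ → Set
Annuls v p = v p ≡ 1

-- Excluded middle makes characteristic functions of arbitrary subsets of ℕ
-- available, as in the classical theory; it is an explicit argument throughout.

module _ (em : ExcludedMiddle 0ℓ) where

  χ : Pred ℕ 0ℓ → ℕ → ℕ
  χ X n = if does (em {n ∈ X}) then 1 else 0

  M : Pred ℕ 0ℓ → Pred ℕ 0ℓ
  M X p = φ (χ X) p 0 1

  jump : Pred ℕ 0ℓ → Pred ℕ 0ℓ
  jump X e = ∃ λ y → φ (χ X) e e y

  CorrectAdjudicator : Pred ℕ 0ℓ → Pred (ℕ → ℕ) 0ℓ
  CorrectAdjudicator X v = ∀ p → Annuls v p ⇔ p ∉ M X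

  AdjudicatorDegree : Pred ℕ 0ℓ → Pred (ℕ → ℕ) 0ℓ
  AdjudicatorDegree X d = ∃ λ v → CorrectAdjudicator X v × v ≡T d

-- A least degree satisfying D, for D a property of degrees.

IsLeastDegree : Pred (ℕ → ℕ) 0ℓ → Pred (ℕ → ℕ) 0ℓ
IsLeastDegree D d = d ∈ D × (∀ d′ → d′ ∈ D → d ≤T d′)

{-# OPTIONS --safe #-}
module Submission where

-- No universal machine is needed: e ∈ X′ iff the program "run e on e, then
-- return 1" lies in M, and p ∈ M iff the program "run p on 0, halt iff the
-- result is 1" halts, and both programs are obtained from the index by pairing.
-- To realise a degree d ≥ X′, let v take the value 1 off M and 2 plus a code of
-- the prefix of d of length p at p ∈ M.  M contains the programs "return n, then
-- return 1", whose codes exceed n, so d can be read off v.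

open import Defs
open import Axiom.ExcludedMiddle using (ExcludedMiddle)
open import Data.Nat.Base using (ℕ; zero; suc; pred; _+_; _∸_; _≤_; _<_; z≤n; s≤s)
open import Data.Nat.Properties
  using (+-comm; +-identityʳ; +-suc; ≤-refl; ≤-trans; ≤-<-trans; <-cmp; m≤m+n; m≤n+m;
         m∸n+n≡m; pred[m∸n]≡m∸[1+n])
open import Data.Product.Base using (∃; _×_; _,_; proj₁; proj₂; map₂)
open import Data.Product.Properties using (,-injective)
open import Function.Base using (_∘_; id)
open import Function.Bundles using (_⇔_; mk⇔; module Equivalence)
open import Level using (0ℓ)
open import Relation.Binary.Definitions using (tri<; tri≈; tri>)
open import Relation.Binary.Core using (Rel; _⇒_)
open import Relation.Binary.PropositionalEquality
  using (_≡_; _≢_; _≗_; refl; sym; trans; cong; cong₂; subst; subst₂; module ≡-Reasoning)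
open import Relation.Nullary.Decidable.Core using (yes; no)
open import Relation.Nullary.Negation.Core using (contradiction)
open import Relation.Unary using (Pred; _∈_; _∉_)

open Equivalence using (to; from)

-- Pairing and the numbering of programs

-- The induction walks the enumeration backwards: down each diagonal in `b`, then to the previous
-- diagonal.
unpair-⟨⟩ : ∀ a b → unpair ⟨ a , b ⟩ ≡ (a , b)
unpair-⟨⟩ a b = go (a + b) a b refl
  where
  go : ∀ s a b → a + b ≡ s → unpair ⟨ a , b ⟩ ≡ (a , b)
  go s a (suc b) eq =
    trans (cong unpair shift) (cong next (go s (suc a) b (trans (sym (+-suc a b)) eq)))
    where
    shift : ⟨ a , suc b ⟩ ≡ suc ⟨ suc a , b ⟩
    shift = trans (+-suc _ b) (cong (λ s → suc (triangle s + b)) (+-suc a b))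
  go s       zero    zero eq = refl
  -- The pair `(suc a , 0)` comes right after `(0 , a)`, the last entry of the previous diagonal.
  go (suc s) (suc a) zero refl
    rewrite +-identityʳ a | +-identityʳ (a + triangle a) | +-comm a (triangle a)
    = cong next (go a zero a refl)

fst-⟨⟩ : ∀ a b → fst ⟨ a , b ⟩ ≡ a
fst-⟨⟩ a b = cong proj₁ (unpair-⟨⟩ a b)

snd-⟨⟩ : ∀ a b → snd ⟨ a , b ⟩ ≡ b
snd-⟨⟩ a b = cong proj₂ (unpair-⟨⟩ a b)

⟨⟩-injective : ∀ a b a′ b′ → ⟨ a , b ⟩ ≡ ⟨ a′ , b′ ⟩ → a ≡ a′ × b ≡ b′
⟨⟩-injective a b a′ b′ eq =
  ,-injective (trans (sym (unpair-⟨⟩ a b)) (trans (cong unpair eq) (unpair-⟨⟩ a′ b′)))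

m+n≤⟨m,n⟩ : ∀ m n → m + n ≤ ⟨ m , n ⟩
m+n≤⟨m,n⟩ m n = ≤-trans (n≤triangle (m + n)) (m≤m+n _ n)
  where
  n≤triangle : ∀ n → n ≤ triangle n
  n≤triangle zero    = z≤n
  n≤triangle (suc n) = m≤m+n (suc n) _

-- A nonzero tag makes the inequality strict. Compound programs have such tags, so the fuel of
-- `decode` suffices for their parts.
n<⟨1+m,n⟩ : ∀ m n → n < ⟨ suc m , n ⟩
n<⟨1+m,n⟩ m n = ≤-trans (s≤s (m≤n+m n m)) (m+n≤⟨m,n⟩ (suc m) n)

-- Decoding and injectivity of the numbering

assemble : ℕ → Code → Code → Code → Code
assemble 0 _ _ _ = zeroᶜ
assemble 1 _ _ _ = succᶜ
assemble 2 _ _ _ = idᶜ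
assemble 3 _ _ _ = fstᶜ
assemble 4 _ _ _ = sndᶜ
assemble 5 _ _ _ = oracleᶜ
assemble 6 _ a b = pairᶜ a b
assemble 7 _ a b = compᶜ a b
assemble 8 _ a b = precᶜ a b
assemble _ c _ _ = minᶜ c

-- The first argument is fuel; any bound exceeding the index suffices.
decode : ℕ → ℕ → Code
decode zero    n = zeroᶜ
decode (suc k) n =
  assemble (fst n) (decode k (snd n)) (decode k (fst (snd n))) (decode k (snd (snd n)))

decode-⟨⟩ : ∀ k m n → decode (suc k) ⟨ m , n ⟩ ≡
  assemble m (decode k n) (decode k (fst n)) (decode k (snd n))
decode-⟨⟩ k m n rewrite fst-⟨⟩ m n | snd-⟨⟩ m n = refl

decode-⟨⟩₂ : ∀ k m a b → decode (suc k) ⟨ m , ⟨ a , b ⟩ ⟩ ≡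
  assemble m (decode k ⟨ a , b ⟩) (decode k a) (decode k b)
decode-⟨⟩₂ k m a b
  rewrite decode-⟨⟩ k m ⟨ a , b ⟩ | fst-⟨⟩ a b | snd-⟨⟩ a b = refl

-- A left inverse yields injectivity of `encode` without comparing constructors pairwise.
decode-encode : ∀ k c → encode c < k → decode k (encode c) ≡ c

decode-encode₂ : ∀ k m a b → ⟨ suc m , ⟨ encode a , encode b ⟩ ⟩ < suc k →
  decode k (encode a) ≡ a × decode k (encode b) ≡ b
decode-encode₂ k m a b (s≤s lt) =
    decode-encode k a (≤-trans (s≤s (≤-trans (m≤m+n _ _) sum≤)) below)
  , decode-encode k b (≤-trans (s≤s (≤-trans (m≤n+m _ _) sum≤)) below)
  where
  sum≤  = m+n≤⟨m,n⟩ (encode a) (encode b)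
  below = ≤-trans (n<⟨1+m,n⟩ m ⟨ encode a , encode b ⟩) lt

decode-encode (suc k) zeroᶜ   lt = refl
decode-encode (suc k) succᶜ   lt = refl
decode-encode (suc k) idᶜ     lt = refl
decode-encode (suc k) fstᶜ    lt = refl
decode-encode (suc k) sndᶜ    lt = refl
decode-encode (suc k) oracleᶜ lt = refl
decode-encode (suc k) (pairᶜ a b) lt
  with p , q ← decode-encode₂ k 5 a b lt =
  trans (decode-⟨⟩₂ k 6 (encode a) (encode b)) (cong₂ pairᶜ p q)
decode-encode (suc k) (compᶜ a b) lt
  with p , q ← decode-encode₂ k 6 a b lt =
  trans (decode-⟨⟩₂ k 7 (encode a) (encode b)) (cong₂ compᶜ p q)
decode-encode (suc k) (precᶜ a b) lt
  with p , q ← decode-encode₂ k 7 a b lt =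
  trans (decode-⟨⟩₂ k 8 (encode a) (encode b)) (cong₂ precᶜ p q)
decode-encode (suc k) (minᶜ a) (s≤s lt) =
  trans (decode-⟨⟩ k 9 (encode a))
        (cong minᶜ (decode-encode k a (≤-trans (n<⟨1+m,n⟩ 8 (encode a)) lt)))

≡decode : ∀ {e} c → encode c ≡ e → c ≡ decode (suc e) e
≡decode c refl = sym (decode-encode _ c ≤-refl)

encode-injective : ∀ c c′ → encode c ≡ encode c′ → c ≡ c′
encode-injective c c′ eq = trans (≡decode c eq) (sym (≡decode c′ refl))

-- Opaque, since unfolding the pairing of open terms makes conversion checking
-- explode.
opaque

  compᵉ : ℕ → ℕ → ℕ
  compᵉ a b = ⟨ 7 , ⟨ a , b ⟩ ⟩

  encode-compᶜ : ∀ a b → encode (compᶜ a b) ≡ compᵉ (encode a) (encode b)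
  encode-compᶜ a b = refl

  compᵉ-injective : ∀ a b a′ b′ → compᵉ a b ≡ compᵉ a′ b′ → a ≡ a′ × b ≡ b′
  compᵉ-injective a b a′ b′ eq =
    ⟨⟩-injective a b a′ b′ (proj₂ (⟨⟩-injective 7 ⟨ a , b ⟩ 7 ⟨ a′ , b′ ⟩ eq))

  decode-compᵉ : ∀ k a b → decode (suc k) (compᵉ a b) ≡ compᶜ (decode k a) (decode k b)
  decode-compᵉ k a b = decode-⟨⟩₂ k 7 a b

  n<compᵉ : ∀ m n → n < compᵉ m n
  n<compᵉ m n =
    ≤-trans (s≤s (≤-trans (m≤n+m n m) (m+n≤⟨m,n⟩ m n))) (n<⟨1+m,n⟩ 6 ⟨ m , n ⟩)

-- `decode` turns every number of the form `compᵉ a b` into a composition, so a program with this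
-- number must be one.
encode≡compᵉ : ∀ c {a b} → encode c ≡ compᵉ a b →
  ∃ λ c₁ → ∃ λ c₂ → c ≡ compᶜ c₁ c₂ × encode c₁ ≡ a × encode c₂ ≡ b
encode≡compᵉ c {a} {b} eq =
  c₁ , c₂ , shape , compᵉ-injective (encode c₁) (encode c₂) a b eq′
  where
  c₁ = decode (compᵉ a b) a
  c₂ = decode (compᵉ a b) b
  shape : c ≡ compᶜ c₁ c₂
  shape = trans (≡decode c eq) (decode-compᵉ (compᵉ a b) a b)
  eq′ : compᵉ (encode c₁) (encode c₂) ≡ compᵉ a b
  eq′ = trans (sym (encode-compᶜ c₁ c₂)) (trans (sym (cong encode shape)) eq)

φ-encode : ∀ {g x y} c → φ g (encode c) x y → ⟦ c ⟧ g x y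
φ-encode {g} {x} {y} c (c′ , eq , run) =
  subst (λ c → ⟦ c ⟧ g x y) (encode-injective c′ c eq) run

-- This holds for arbitrary indices: if `a` or `b` encodes no program, both sides are empty.
φ-compᵉ : ∀ {g a b x y} → φ g (compᵉ a b) x y ⇔ (∃ λ u → φ g b x u × φ g a u y)
φ-compᵉ {g} {a} {b} {x} {y} = mk⇔ split join
  where
  split : φ g (compᵉ a b) x y → ∃ λ u → φ g b x u × φ g a u y
  split (c , eq , run) with encode≡compᵉ c eq
  ... | c₁ , c₂ , refl , eq₁ , eq₂ with u , run₂ , run₁ ← run =
    u , (c₂ , eq₂ , run₂) , (c₁ , eq₁ , run₁)
  join : (∃ λ u → φ g b x u × φ g a u y) → φ g (compᵉ a b) x y
  join (u , (c₂ , refl , run₂) , (c₁ , refl , run₁)) = compᶜ c₁ c₂ , encode-compᶜ c₁ c₂ , u , run₂ , run₁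

-- Determinism of programs and substitution for the oracle

⟦⟧-functional : ∀ c {g x y y′} → ⟦ c ⟧ g x y → ⟦ c ⟧ g x y′ → y ≡ y′
⟦⟧-functional zeroᶜ   refl refl = refl
⟦⟧-functional succᶜ   refl refl = refl
⟦⟧-functional idᶜ     refl refl = refl
⟦⟧-functional fstᶜ    refl refl = refl
⟦⟧-functional sndᶜ    refl refl = refl
⟦⟧-functional oracleᶜ refl refl = refl
⟦⟧-functional (pairᶜ a b) (_ , _ , p , q , refl) (_ , _ , p′ , q′ , refl) =
  cong₂ ⟨_,_⟩ (⟦⟧-functional a p p′) (⟦⟧-functional b q q′)
⟦⟧-functional (compᶜ a b) (_ , q , p) (_ , q′ , p′) with ⟦⟧-functional b q q′
... | refl = ⟦⟧-functional a p p′
⟦⟧-functional (precᶜ a b) {g} {x} = go (snd x)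
  where
  go : ∀ n {y y′} → PrimRec (⟦ a ⟧ g) (⟦ b ⟧ g) (fst x) n y →
       PrimRec (⟦ a ⟧ g) (⟦ b ⟧ g) (fst x) n y′ → y ≡ y′
  go zero    p p′ = ⟦⟧-functional a p p′
  go (suc n) (_ , p , q) (_ , p′ , q′) with go n p p′
  ... | refl = ⟦⟧-functional b q q′
⟦⟧-functional (minᶜ a) {y = y} {y′} (p , below) (p′ , below′) with <-cmp y y′
... | tri≈ _ eq _ = eq
-- The smaller zero is a point where the other search requires a positive value.
... | tri< lt _ _ with () ← ⟦⟧-functional a p (proj₂ (below′ y lt))
... | tri> _ _ gt with () ← ⟦⟧-functional a p′ (proj₂ (below y′ gt))

PrimRec-map : ∀ {F F′ G G′ : Rel ℕ 0ℓ} → F ⇒ F′ → G ⇒ G′ → ∀ {a} n {y} →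
  PrimRec F G a n y → PrimRec F′ G′ a n y
PrimRec-map f g zero    p           = f p
PrimRec-map f g (suc n) (r , p , q) = r , PrimRec-map f g n p , g q

_[_] : Code → Code → Code
zeroᶜ     [ d ] = zeroᶜ
succᶜ     [ d ] = succᶜ
idᶜ       [ d ] = idᶜ
fstᶜ      [ d ] = fstᶜ
sndᶜ      [ d ] = sndᶜ
oracleᶜ   [ d ] = d
pairᶜ a b [ d ] = pairᶜ (a [ d ]) (b [ d ])
compᶜ a b [ d ] = compᶜ (a [ d ]) (b [ d ])
precᶜ a b [ d ] = precᶜ (a [ d ]) (b [ d ])
minᶜ a    [ d ] = minᶜ (a [ d ])

module _ {g h : ℕ → ℕ} {d : Code} (computes : ∀ x → ⟦ d ⟧ h x (g x)) where

  -- Graphs of subprograms occur only positively in the semantics, minimisation included, so the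
  -- inclusion passes through every constructor.
  []-sound : ∀ c → ⟦ c ⟧ g ⇒ ⟦ c [ d ] ⟧ h
  []-sound zeroᶜ   p = p
  []-sound succᶜ   p = p
  []-sound idᶜ     p = p
  []-sound fstᶜ    p = p
  []-sound sndᶜ    p = p
  []-sound oracleᶜ refl = computes _
  []-sound (pairᶜ a b) (u , v , p , q , eq) = u , v , []-sound a p , []-sound b q , eq
  []-sound (compᶜ a b) (u , p , q) = u , []-sound b p , []-sound a q
  []-sound (precᶜ a b) {x} p = PrimRec-map ([]-sound a) ([]-sound b) (snd x) p
  []-sound (minᶜ a) (p , below) = []-sound a p , λ z lt → map₂ ([]-sound a) (below z lt)

-- A calculus of total relatively computable functions

infix 4 _≤ᶜ_

-- Carrying the program instead of its number lets witnesses be composed directly.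
_≤ᶜ_ : Rel (ℕ → ℕ) 0ℓ
f ≤ᶜ g = ∃ λ c → ∀ x → ⟦ c ⟧ g x (f x)

≤ᶜ⇒≤T : ∀ {f g} → f ≤ᶜ g → f ≤T g
≤ᶜ⇒≤T (c , run) = encode c , λ x → c , refl , run x

≤T⇒≤ᶜ : ∀ {f g} → f ≤T g → f ≤ᶜ g
-- Convergence at 0 shows that `e` encodes a program; injectivity of `encode` makes it the program
-- of every other run.
≤T⇒≤ᶜ (e , runs) with c , refl , _ ← runs 0 = c , λ x → φ-encode c (runs x)

≤ᶜ-refl : ∀ {g} → g ≤ᶜ g
≤ᶜ-refl = oracleᶜ , λ x → refl

≤ᶜ-trans : ∀ {f g h} → f ≤ᶜ g → g ≤ᶜ h → f ≤ᶜ h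
≤ᶜ-trans (c , run) (d , computes) = c [ d ] , λ x → []-sound computes c (run x)

≤T-refl : ∀ {g} → g ≤T g
≤T-refl = ≤ᶜ⇒≤T ≤ᶜ-refl

≤T-trans : ∀ {f g h} → f ≤T g → g ≤T h → f ≤T h
≤T-trans p q = ≤ᶜ⇒≤T (≤ᶜ-trans (≤T⇒≤ᶜ p) (≤T⇒≤ᶜ q))

≤ᶜ-resp-≗ : ∀ {f f′ g} → f ≗ f′ → f ≤ᶜ g → f′ ≤ᶜ g
≤ᶜ-resp-≗ {g = g} eq (c , run) = c , λ x → subst (⟦ c ⟧ g x) (eq x) (run x)

constᶜ : ℕ → Code
constᶜ zero    = zeroᶜ
constᶜ (suc n) = compᶜ succᶜ (constᶜ n)

⟦constᶜ⟧ : ∀ {g} n x → ⟦ constᶜ n ⟧ g x n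
⟦constᶜ⟧ zero    x = refl
⟦constᶜ⟧ (suc n) x = n , ⟦constᶜ⟧ n x , refl

natrec : ℕ → (ℕ → ℕ → ℕ) → ℕ → ℕ
natrec z s zero    = z
natrec z s (suc n) = s n (natrec z s n)

module _ {g : ℕ → ℕ} where

  const≤ᶜ : ∀ n → (λ _ → n) ≤ᶜ g
  const≤ᶜ n = constᶜ n , ⟦constᶜ⟧ n

  id≤ᶜ : id ≤ᶜ g
  id≤ᶜ = idᶜ , λ x → refl

  fst≤ᶜ : fst ≤ᶜ g
  fst≤ᶜ = fstᶜ , λ x → refl

  snd≤ᶜ : snd ≤ᶜ g
  snd≤ᶜ = sndᶜ , λ x → refl

  suc≤ᶜ : suc ≤ᶜ g
  suc≤ᶜ = succᶜ , λ x → refl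

  pair≤ᶜ : ∀ {f h} → f ≤ᶜ g → h ≤ᶜ g → (λ x → ⟨ f x , h x ⟩) ≤ᶜ g
  pair≤ᶜ (a , p) (b , q) = pairᶜ a b , λ x → _ , _ , p x , q x , refl

  comp≤ᶜ : ∀ {f h} → f ≤ᶜ g → h ≤ᶜ g → (f ∘ h) ≤ᶜ g
  comp≤ᶜ {h = h} (a , p) (b , q) = compᶜ a b , λ x → _ , q x , p (h x)

  natrec≤ᶜ : ∀ {z k} (s : ℕ → ℕ → ℕ → ℕ) →
    z ≤ᶜ g → (λ t → s (fst t) (fst (snd t)) (snd (snd t))) ≤ᶜ g → k ≤ᶜ g →
    (λ x → natrec (z x) (s x) (k x)) ≤ᶜ g
  natrec≤ᶜ {z} {k} s (a , p) (b , q) k≤g =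
    compᶜ (precᶜ a b) (proj₁ paired) , λ x →
      _ , proj₂ paired x ,
      subst₂ (λ m n → PrimRec (⟦ a ⟧ g) (⟦ b ⟧ g) m n (natrec (z x) (s x) (k x)))
        (sym (fst-⟨⟩ x (k x))) (sym (snd-⟨⟩ x (k x))) (run x (k x))
    where
    paired = pair≤ᶜ id≤ᶜ k≤g
    step : ∀ x n r → ⟦ b ⟧ g ⟨ x , ⟨ n , r ⟩ ⟩ (s x n r)
    step x n r with q ⟨ x , ⟨ n , r ⟩ ⟩
    ... | t rewrite fst-⟨⟩ x ⟨ n , r ⟩ | snd-⟨⟩ x ⟨ n , r ⟩ | fst-⟨⟩ n r | snd-⟨⟩ n r = t
    run : ∀ x n → PrimRec (⟦ a ⟧ g) (⟦ b ⟧ g) x n (natrec (z x) (s x) n)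
    run x zero    = p x
    run x (suc n) = natrec (z x) (s x) n , run x n , step x n _

  pred≤ᶜ : pred ≤ᶜ g
  pred≤ᶜ = ≤ᶜ-resp-≗ (λ { zero → refl ; (suc n) → refl })
    (natrec≤ᶜ (λ _ n _ → n) (const≤ᶜ 0) (comp≤ᶜ fst≤ᶜ snd≤ᶜ) id≤ᶜ)

  ∸≤ᶜ : ∀ {f h} → f ≤ᶜ g → h ≤ᶜ g → (λ x → f x ∸ h x) ≤ᶜ g
  ∸≤ᶜ {f} {h} p q = ≤ᶜ-resp-≗ (λ x → natrec-pred (f x) (h x))
    (natrec≤ᶜ (λ _ _ r → pred r) p (comp≤ᶜ pred≤ᶜ (comp≤ᶜ snd≤ᶜ snd≤ᶜ)) q)
    where
    natrec-pred : ∀ m n → natrec m (λ _ → pred) n ≡ m ∸ n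
    natrec-pred m zero    = refl
    natrec-pred m (suc n) =
      trans (cong pred (natrec-pred m n)) (pred[m∸n]≡m∸[1+n] m n)

  opaque
    unfolding compᵉ

    compᵉ≤ᶜ : ∀ {f h} → f ≤ᶜ g → h ≤ᶜ g → (λ x → compᵉ (f x) (h x)) ≤ᶜ g
    compᵉ≤ᶜ p q = pair≤ᶜ (const≤ᶜ 7) (pair≤ᶜ p q)

  encode-constᶜ≤ᶜ : (λ n → encode (constᶜ n)) ≤ᶜ g
  encode-constᶜ≤ᶜ = ≤ᶜ-resp-≗ natrec-compᵉ
    (natrec≤ᶜ (λ _ _ r → compᵉ (encode succᶜ) r) (const≤ᶜ 0)
      (compᵉ≤ᶜ (const≤ᶜ (encode succᶜ)) (comp≤ᶜ snd≤ᶜ snd≤ᶜ)) id≤ᶜ)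
    where
    natrec-compᵉ : ∀ n → natrec 0 (λ _ → compᵉ (encode succᶜ)) n ≡ encode (constᶜ n)
    natrec-compᵉ zero    = refl
    natrec-compᵉ (suc n) = trans (cong (compᵉ (encode succᶜ)) (natrec-compᵉ n))
                                 (sym (encode-compᶜ succᶜ (constᶜ n)))

-- Used twice: to turn verdicts into bits, and as the condition of an unbounded search.
≢1? : ℕ → ℕ
≢1? = natrec 1 (λ n _ → natrec 0 (λ _ _ → 1) n)

≢1?≤ᶜ : ∀ {g} → ≢1? ≤ᶜ g
≢1?≤ᶜ = natrec≤ᶜ (λ _ n _ → natrec 0 (λ _ _ → 1) n) (const≤ᶜ 1)
  (natrec≤ᶜ (λ _ _ _ → 1) (const≤ᶜ 0) (const≤ᶜ 1) (comp≤ᶜ fst≤ᶜ snd≤ᶜ)) id≤ᶜ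

≢1?-≢1 : ∀ {n} → n ≢ 1 → ≢1? n ≡ 1
≢1?-≢1 {zero}        n≢1 = refl
≢1?-≢1 {suc zero}    n≢1 = contradiction refl n≢1
≢1?-≢1 {suc (suc n)} n≢1 = refl

-- Prefixes of a function

-- The latest value is outermost, so `fst` shortens a prefix by one entry and `snd` reads its last
-- entry.
prefix : (ℕ → ℕ) → ℕ → ℕ
prefix d = natrec 0 (λ n r → ⟨ r , d n ⟩)

drop : ℕ → ℕ → ℕ
drop k n = natrec n (λ _ → fst) k

drop-prefix : ∀ d k n → drop k (prefix d (k + n)) ≡ prefix d n
drop-prefix d zero    n = refl
drop-prefix d (suc k) n = begin
  fst (drop k (prefix d (suc k + n)))
    ≡⟨ cong (λ m → fst (drop k (prefix d m))) (sym (+-suc k n)) ⟩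
  fst (drop k (prefix d (k + suc n)))
    ≡⟨ cong fst (drop-prefix d k (suc n)) ⟩
  fst ⟨ prefix d n , d n ⟩
    ≡⟨ fst-⟨⟩ (prefix d n) (d n) ⟩
  prefix d n ∎
  where open ≡-Reasoning

prefix-lookup : ∀ d {n p} → n < p → snd (drop (p ∸ suc n) (prefix d p)) ≡ d n
prefix-lookup d {n} {p} n<p = begin
  snd (drop (p ∸ suc n) (prefix d p))
    -- Dropping `p ∸ suc n` entries leaves length `suc n`, whose last entry is `d n`; `n < p` makes
    -- the subtraction exact.
    ≡⟨ cong (λ p′ → snd (drop (p ∸ suc n) (prefix d p′))) (sym (m∸n+n≡m n<p)) ⟩
  snd (drop (p ∸ suc n) (prefix d (p ∸ suc n + suc n)))
    ≡⟨ cong snd (drop-prefix d (p ∸ suc n) (suc n)) ⟩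
  snd ⟨ prefix d n , d n ⟩
    ≡⟨ snd-⟨⟩ (prefix d n) (d n) ⟩
  d n ∎
  where open ≡-Reasoning

prefix≤ᶜ : ∀ {d} → prefix d ≤ᶜ d
prefix≤ᶜ {d} = natrec≤ᶜ (λ _ n r → ⟨ r , d n ⟩) (const≤ᶜ 0)
  (pair≤ᶜ (comp≤ᶜ snd≤ᶜ snd≤ᶜ) (comp≤ᶜ ≤ᶜ-refl (comp≤ᶜ fst≤ᶜ snd≤ᶜ))) id≤ᶜ

-- The two many-one reductions

-- The inner constant program replaces the input 0 by `e`; the outer one replaces any output by 1.
selfThenOne : ℕ → ℕ
selfThenOne e = compᵉ (encode (constᶜ 1)) (compᵉ e (encode (constᶜ e)))

selfThenOne≤ᶜ : ∀ {g} → selfThenOne ≤ᶜ g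
selfThenOne≤ᶜ =
  compᵉ≤ᶜ (const≤ᶜ (encode (constᶜ 1))) (compᵉ≤ᶜ id≤ᶜ encode-constᶜ≤ᶜ)

φ-selfThenOne : ∀ {g e} → φ g (selfThenOne e) 0 1 ⇔ (∃ λ y → φ g e e y)
φ-selfThenOne {g} {e} = mk⇔ halts returns
  where
  halts : φ g (selfThenOne e) 0 1 → ∃ λ y → φ g e e y
  halts run with u , run₂ , _ ← to φ-compᵉ run
            with n , run₃ , run₄ ← to φ-compᵉ run₂
            with refl ← ⟦⟧-functional (constᶜ e) (φ-encode (constᶜ e) run₃) (⟦constᶜ⟧ {g} e 0)
    = u , run₄
  returns : (∃ λ y → φ g e e y) → φ g (selfThenOne e) 0 1
  returns (y , run) = from φ-compᵉ
    ( y , from φ-compᵉ (e , (constᶜ e , refl , ⟦constᶜ⟧ {g} e 0) , run)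
    , (constᶜ 1 , refl , ⟦constᶜ⟧ {g} 1 y))

module _ (g : ℕ → ℕ) where

  ≢1?∘fst≤ᶜ : (≢1? ∘ fst) ≤ᶜ g
  ≢1?∘fst≤ᶜ = comp≤ᶜ ≢1?≤ᶜ fst≤ᶜ

  opaque

    -- Searches for z with ≢1? x ≡ 0, a condition not involving z.
    halt-at-1ᶜ : Code
    halt-at-1ᶜ = minᶜ (proj₁ ≢1?∘fst≤ᶜ)

    ⟦halt-at-1ᶜ⟧⇒≡1 : ∀ {x y} → ⟦ halt-at-1ᶜ ⟧ g x y → x ≡ 1
    ⟦halt-at-1ᶜ⟧⇒≡1 {x} {y} (run , _) = ≢1?≡0⇒≡1 x
      (trans (cong ≢1? (sym (fst-⟨⟩ x y)))
             (⟦⟧-functional (proj₁ ≢1?∘fst≤ᶜ) {g} {⟨ x , y ⟩}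
               (proj₂ ≢1?∘fst≤ᶜ ⟨ x , y ⟩) run))
      where
      ≢1?≡0⇒≡1 : ∀ n → ≢1? n ≡ 0 → n ≡ 1
      ≢1?≡0⇒≡1 (suc zero) _ = refl

    ⟦halt-at-1ᶜ⟧-1 : ⟦ halt-at-1ᶜ ⟧ g 1 0
    ⟦halt-at-1ᶜ⟧-1 = proj₂ ≢1?∘fst≤ᶜ ⟨ 1 , 0 ⟩ , λ _ ()

  haltIffOne : ℕ → ℕ
  haltIffOne p = compᵉ (encode halt-at-1ᶜ) (compᵉ p (encode zeroᶜ))

  haltIffOne≤ᶜ : ∀ {h} → haltIffOne ≤ᶜ h
  haltIffOne≤ᶜ =
    compᵉ≤ᶜ (const≤ᶜ (encode halt-at-1ᶜ)) (compᵉ≤ᶜ id≤ᶜ (const≤ᶜ (encode zeroᶜ)))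

  -- `zeroᶜ` discards the input, so `x` may be the index `haltIffOne p` itself, as the jump demands.
  φ-haltIffOne : ∀ {p x} → (∃ λ y → φ g (haltIffOne p) x y) ⇔ φ g p 0 1
  φ-haltIffOne {p} {x} = mk⇔ returns halts
    where
    returns : (∃ λ y → φ g (haltIffOne p) x y) → φ g p 0 1
    returns (y , run)
      with u , run₂ , run₁ ← to φ-compᵉ run
      with n , run₃ , run₄ ← to φ-compᵉ run₂
      with refl ← φ-encode zeroᶜ run₃
      with refl ← ⟦halt-at-1ᶜ⟧⇒≡1 (φ-encode halt-at-1ᶜ run₁)
      = run₄
    halts : φ g p 0 1 → ∃ λ y → φ g (haltIffOne p) x y
    halts run = 0 , from φ-compᵉ
      ( 1 , from φ-compᵉ (0 , (zeroᶜ , refl , refl) , run)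
      , (halt-at-1ᶜ , refl , ⟦halt-at-1ᶜ⟧-1))

-- Members of `M` with arbitrarily large index

returnOne : ℕ → ℕ
returnOne n = compᵉ (encode (constᶜ 1)) (encode (constᶜ n))

returnOne≤ᶜ : ∀ {g} → returnOne ≤ᶜ g
returnOne≤ᶜ = compᵉ≤ᶜ (const≤ᶜ (encode (constᶜ 1))) encode-constᶜ≤ᶜ

φ-returnOne : ∀ {g} n → φ g (returnOne n) 0 1
φ-returnOne {g} n = from φ-compᵉ
  (n , (constᶜ n , refl , ⟦constᶜ⟧ {g} n 0) , (constᶜ 1 , refl , ⟦constᶜ⟧ {g} 1 n))

-- Each successor in `constᶜ n` raises the code. Hence the prefix of length `returnOne n` contains
-- `d n`.
n<returnOne : ∀ n → n < returnOne n
n<returnOne n = ≤-<-trans (n≤encode-constᶜ n) (n<compᵉ (encode (constᶜ 1)) (encode (constᶜ n)))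
  where
  n≤encode-constᶜ : ∀ n → n ≤ encode (constᶜ n)
  n≤encode-constᶜ zero    = z≤n
  n≤encode-constᶜ (suc n) =
    subst (n <_) (sym (encode-compᶜ succᶜ (constᶜ n)))
      (≤-<-trans (n≤encode-constᶜ n) (n<compᵉ (encode succᶜ) (encode (constᶜ n))))

-- Adjudicators

module _ (em : ExcludedMiddle 0ℓ) where

  χ-∈ : ∀ {P n} → n ∈ P → χ em P n ≡ 1
  χ-∈ {P} {n} n∈P with em {n ∈ P}
  ... | yes _  = refl
  ... | no n∉P = contradiction n∈P n∉P

  χ-∉ : ∀ {P n} → n ∉ P → χ em P n ≡ 0
  χ-∉ {P} {n} n∉P with em {n ∈ P}
  ... | yes n∈P = contradiction n∈P n∉P
  ... | no _    = refl

  module _ (X : Pred ℕ 0ℓ) where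

    private
      J = jump em X
      K = χ em J

    -- An exempting value may be any number other than 1; `≢1?` normalises it to 1 and sends the
    -- annulling value to 0.
    jump≤adjudicator : ∀ v → CorrectAdjudicator em X v → K ≤T v
    jump≤adjudicator v correct =
      ≤ᶜ⇒≤T (≤ᶜ-resp-≗ agree (comp≤ᶜ ≢1?≤ᶜ (comp≤ᶜ ≤ᶜ-refl selfThenOne≤ᶜ)))
      where
      agree : ∀ e → ≢1? (v (selfThenOne e)) ≡ K e
      agree e with em {e ∈ J}
      ... | yes e∈J =
        ≢1?-≢1 λ annuls → to (correct (selfThenOne e)) annuls (from φ-selfThenOne e∈J)
      ... | no e∉J =
        cong ≢1? (from (correct (selfThenOne e)) (e∉J ∘ to φ-selfThenOne))

    -- `natrec` branches on the bit supplied by `K`; the offset 2 keeps exempting values away from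
    -- 1.
    codingAdjudicator : (ℕ → ℕ) → ℕ → ℕ
    codingAdjudicator d p =
      natrec 1 (λ _ _ → 2 + prefix d p) (K (haltIffOne (χ em X) p))

    module _ (d : ℕ → ℕ) where

      coding-∈ : ∀ {p} → p ∈ M em X → codingAdjudicator d p ≡ 2 + prefix d p
      coding-∈ {p} p∈M =
        cong (natrec 1 (λ _ _ → 2 + prefix d p)) (χ-∈ {J} (from (φ-haltIffOne (χ em X)) p∈M))

      coding-∉ : ∀ {p} → p ∉ M em X → codingAdjudicator d p ≡ 1
      coding-∉ {p} p∉M =
        cong (natrec 1 (λ _ _ → 2 + prefix d p)) (χ-∉ {J} (p∉M ∘ to (φ-haltIffOne (χ em X))))

      coding-correct : CorrectAdjudicator em X (codingAdjudicator d)
      coding-correct p = mk⇔ (λ annuls p∈M → 2+n≢1 (trans (sym (coding-∈ p∈M)) annuls)) coding-∉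
        where
        2+n≢1 : ∀ {n} → 2 + n ≢ 1
        2+n≢1 ()

      coding≤ᶜ : K ≤ᶜ d → codingAdjudicator d ≤ᶜ d
      coding≤ᶜ K≤d = natrec≤ᶜ (λ p _ _ → 2 + prefix d p) (const≤ᶜ 1)
        (comp≤ᶜ suc≤ᶜ (comp≤ᶜ suc≤ᶜ (comp≤ᶜ prefix≤ᶜ fst≤ᶜ)))
        (comp≤ᶜ K≤d (haltIffOne≤ᶜ (χ em X)))

      ≤ᶜcoding : d ≤ᶜ codingAdjudicator d
      ≤ᶜcoding = ≤ᶜ-resp-≗ agree
        -- The query `returnOne n` always lies in `M`, so the answer is a shifted prefix: two
        -- `pred`s undo the offset, iterated `fst` shortens it, and `snd` reads `d n`.
        (comp≤ᶜ snd≤ᶜ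
          (natrec≤ᶜ (λ _ _ r → fst r)
            (comp≤ᶜ pred≤ᶜ (comp≤ᶜ pred≤ᶜ (comp≤ᶜ ≤ᶜ-refl returnOne≤ᶜ)))
            (comp≤ᶜ fst≤ᶜ (comp≤ᶜ snd≤ᶜ snd≤ᶜ))
            (∸≤ᶜ returnOne≤ᶜ suc≤ᶜ)))
        where
        agree : ∀ n → snd (drop (returnOne n ∸ suc n)
                                (pred (pred (codingAdjudicator d (returnOne n))))) ≡ d n
        agree n rewrite coding-∈ (φ-returnOne n) = prefix-lookup d (n<returnOne n)

      coding≡T : K ≤T d → codingAdjudicator d ≡T d
      coding≡T K≤d = ≤ᶜ⇒≤T (coding≤ᶜ (≤T⇒≤ᶜ K≤d)) , ≤ᶜ⇒≤T ≤ᶜcoding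

    adjudicatorDegree : ∀ d → AdjudicatorDegree em X d ⇔ K ≤T d
    adjudicatorDegree d = mk⇔
      (λ (v , correct , v≤d , _) → ≤T-trans {K} {v} {d} (jump≤adjudicator v correct) v≤d)
      (λ K≤d → codingAdjudicator d , coding-correct d , coding≡T d K≤d)

-- The second clause speaks of `w` computing some correct adjudicator: a function above the jump
-- need not itself be one, for instance if it never takes the value 1.
theorem6p1 : (em : ExcludedMiddle 0ℓ) (X : Pred ℕ 0ℓ) →
    (∀ v → CorrectAdjudicator em X v → χ em (jump em X) ≤T v)
    × (∀ w → (∃ λ v → CorrectAdjudicator em X v × v ≤T w) ⇔ χ em (jump em X) ≤T w)
    × (∀ d → AdjudicatorDegree em X d ⇔ χ em (jump em X) ≤T d)
    × IsLeastDegree (AdjudicatorDegree em X) (χ em (jump em X))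
theorem6p1 em X =
    jump≤adjudicator em X
  , (λ w → mk⇔
      (λ (v , correct , v≤w) → ≤T-trans (jump≤adjudicator em X v correct) v≤w)
      (λ K≤w → let v , correct , v≤w , _ = from (adjudicatorDegree em X w) K≤w
               in v , correct , v≤w))
  , adjudicatorDegree em X
  -- The equivalence at the jump itself shows that the lower bound is attained.
  , from (adjudicatorDegree em X _) ≤T-refl
  , (λ d → to (adjudicatorDegree em X d))
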